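{- Let $G$ be a finite, simple, undirected, connected graph with at least two vertices and let $v \in V(G)$. The following statements are equivalent: (i) $v$ is the $\mathcal{L}$-root leaf of some DFS ordering of $G$ starting in $v$; (ii) $v$ is the $\mathcal{L}$-root leaf of every DFS ordering of $G$ starting in $v$; (iii) $v$ is the $\mathcal{L}$-root leaf of some MCS ordering of $G$; (iv) $v$ is the $\mathcal{L}$-root leaf of some GS ordering of $G$; (v) $v$ is an $\mathcal{L}$-branch leaf of some GS ordering of $G$; (vi) $v$ is an $\mathcal{F}$-branch leaf of some GS ordering of $G$; (vii) $v$ is the end-vertex (last vertex) of some GS ordering of $G$; (viii) $v$ is not a cut vertex of $G$.
   Context: A vertex ordering of $G$ is a bijection $\sigma:\{1,\dots,n\}\to V(G)$; $u \prec_\sigma w$ means $u$ comes before $w$. Searches are defined by the following label search: initially every vertex has label $\emptyset$; for $i=1,\dots,n$, choose any unnumbered vertex $x$ such that there is no unnumbered $y$ with $\mathrm{label}(x) \prec_{\mathcal{A}} \mathrm{label}(y)$, set $\sigma(i)=x$, and add $i$ to the labels of all unnumbered neighbors of $x$. The orderings produced this way are the $\mathcal{A}$-orderings. Generic Search (GS): $A \prec B$ iff $A=\emptyset$ and $B\neq\emptyset$. Depth First Search (DFS): $A \prec B$ iff ($A=\emptyset$ and $B\neq\emptyset$) or $\max(A)<\max(B)$. Maximum Cardinality Search (MCS): $A \prec B$ iff $|A|<|B|$. For a GS ordering $\sigma$ of a connected graph $G$, the $\mathcal{F}$-tree of $\sigma$ is the spanning tree containing, for each vertex $v\neq\sigma(1)$,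 the edge from $v$ to its leftmost neighbor in $\sigma$; the $\mathcal{L}$-tree of $\sigma$ contains, for each $v \neq \sigma(1)$, the edge from $v$ to its rightmost neighbor $w$ with $w \prec_\sigma v$. A vertex is an $\mathcal{F}$-leaf ($\mathcal{L}$-leaf) of $\sigma$ if it is a leaf of the $\mathcal{F}$-tree ($\mathcal{L}$-tree) of $\sigma$; it is the $\mathcal{F}$-root leaf ($\mathcal{L}$-root leaf) if additionally it is $\sigma(1)$, and an $\mathcal{F}$-branch leaf ($\mathcal{L}$-branch leaf) otherwise. -}

module Defs where

open import Level using (0ℓ)
open import Data.Bool using (if_then_else_; _∧_)
open import Data.Fin using (Fin; toℕ; fromℕ<)
import Data.Fin as Fin
open import Data.Fin.Permutation using (Permutation′; _⟨$⟩ʳ_; _⟨$⟩ˡ_)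
open import Data.Fin.Properties using (toℕ≤n)
open import Data.Fin.Subset using (Subset; ⊥; ⁅_⁆; _∪_; _∈_; ∣_∣; Empty; Nonempty)
open import Data.List using (List; lookup)
open import Data.Nat using (ℕ; zero; suc; _≤_; _<_)
open import Data.Nat.Properties using (<⇒≤)
open import Data.Product using (∃; ∃!; ∃₂; _×_; proj₁)
open import Data.Sum using (_⊎_)
open import Function using (_⇔_; _on_)
open import Relation.Binary using (Rel; Symmetric; Irreflexive; Decidable)
open import Relation.Binary.Construct.Closure.ReflexiveTransitive using (Star)
open import Relation.Binary.Construct.Closure.Symmetric using (SymClosure)
open import Relation.Binary.PropositionalEquality using (_≡_; _≢_; cong)
open import Relation.Nullary using (¬_; does)

record Graph (V : Set) : Set₁ where
  field
    Adj    : Rel V 0ℓ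
    adj?   : Decidable Adj
    sym    : Symmetric Adj
    irrefl : Irreflexive _≡_ Adj

open Graph public

Connected : ∀ {V} → Graph V → Set
Connected G = ∀ u w → Star (Adj G) u w

_-ᵛ_ : ∀ {V} → Graph V → (v : V) → Graph (∃ λ u → u ≢ v)
Adj    (G -ᵛ v)     = Adj G on proj₁
adj?   (G -ᵛ v) a b = adj? G (proj₁ a) (proj₁ b)
sym    (G -ᵛ v)     = sym G
irrefl (G -ᵛ v) eq  = irrefl G (cong proj₁ eq)

-- For connected graphs only: in general, a cut vertex is one whose removal
-- increases the number of connected components.
CutVertex : ∀ {V} → Graph V → V → Set
CutVertex G v = ¬ Connected (G -ᵛ v)

-- Positions and vertices are both elements of Fin n: σ ⟨$⟩ʳ i is the vertex at
-- position i and σ ⟨$⟩ˡ v is the position of v.  Positions count from 0.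
Ordering : ℕ → Set
Ordering = Permutation′

module _ {n : ℕ} (σ : Ordering n) where

  Precedes : Rel (Fin n) 0ℓ
  Precedes u w = σ ⟨$⟩ˡ u Fin.< σ ⟨$⟩ˡ w

  PrecedesEq : Rel (Fin n) 0ℓ
  PrecedesEq u w = σ ⟨$⟩ˡ u Fin.≤ σ ⟨$⟩ˡ w

  IsFirst : Fin n → Set
  IsFirst v = toℕ (σ ⟨$⟩ˡ v) ≡ 0

  IsLast : Fin n → Set
  IsLast v = suc (toℕ (σ ⟨$⟩ˡ v)) ≡ n

-- label G σ k _ y is the label of y once k vertices have been numbered, when
-- the search numbers the vertices in the order σ.  In step i the unnumbered
-- vertices, after σ ⟨$⟩ʳ i itself has been numbered, are those at positions > i.
label : ∀ {n} → Graph (Fin n) → Ordering n → (k : ℕ) → .(k ≤ n) → Fin n → Subset n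
label G σ zero    _   y = ⊥
label G σ (suc k) k<n y =
  if does (i Fin.<? σ ⟨$⟩ˡ y) ∧ does (adj? G (σ ⟨$⟩ʳ i) y)
  then ⁅ i ⁆ ∪ label G σ k (<⇒≤ k<n) y
  else label G σ k (<⇒≤ k<n) y
  where i = fromℕ< k<n

LabelOrder : Set₁
LabelOrder = ∀ {n} → Rel (Subset n) 0ℓ

IsSearchOrdering : LabelOrder → ∀ {n} → Graph (Fin n) → Ordering n → Set
IsSearchOrdering _≺_ {n} G σ =
  ∀ (i : Fin n) → ¬ (∃ λ y → i Fin.≤ σ ⟨$⟩ˡ y × labelAt i (σ ⟨$⟩ʳ i) ≺ labelAt i y)
  where
  labelAt : Fin n → Fin n → Subset n
  labelAt i = label G σ (toℕ i) (toℕ≤n i)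

IsMax : ∀ {n} → Subset n → Fin n → Set
IsMax A m = m ∈ A × (∀ {j} → j ∈ A → j Fin.≤ m)

_≺GS_ : LabelOrder
A ≺GS B = Empty A × Nonempty B

-- max(A) < max(B) is read as requiring both maxima to exist.
_≺DFS_ : LabelOrder
A ≺DFS B = (Empty A × Nonempty B) ⊎ (∃₂ λ a b → IsMax A a × IsMax B b × a Fin.< b)

_≺MCS_ : LabelOrder
A ≺MCS B = ∣ A ∣ < ∣ B ∣

module _ {n : ℕ} (G : Graph (Fin n)) (σ : Ordering n) where

  IsGS IsDFS IsMCS : Set
  IsGS  = IsSearchOrdering _≺GS_ G σ
  IsDFS = IsSearchOrdering _≺DFS_ G σ
  IsMCS = IsSearchOrdering _≺MCS_ G σ

  FParent : Rel (Fin n) 0ℓ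
  FParent v p = ¬ IsFirst σ v × Adj G v p × (∀ w → Adj G v w → PrecedesEq σ p w)

  LParent : Rel (Fin n) 0ℓ
  LParent v p = ¬ IsFirst σ v × Adj G v p × Precedes σ p v
              × (∀ w → Adj G v w → Precedes σ w v → PrecedesEq σ w p)

  -- Edge relations of the spanning trees.  They are trees when G is connected
  -- and σ is a GS ordering, the only case in which they are used.
  FTree LTree : Rel (Fin n) 0ℓ
  FTree = SymClosure FParent
  LTree = SymClosure LParent

-- A vertex of degree one.
Leaf : ∀ {V : Set} → Rel V 0ℓ → V → Set
Leaf E v = ∃! _≡_ (E v)

module _ {n : ℕ} (G : Graph (Fin n)) (σ : Ordering n) (v : Fin n) where

  LRootLeaf LBranchLeaf FBranchLeaf : Set
  LRootLeaf   = Leaf (LTree G σ) v × IsFirst σ v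
  LBranchLeaf = Leaf (LTree G σ) v × ¬ IsFirst σ v
  FBranchLeaf = Leaf (FTree G σ) v × ¬ IsFirst σ v

AllEquivalent : List Set → Set
AllEquivalent Ps = ∀ i j → lookup Ps i ⇔ lookup Ps j

-- The leaf and last-vertex conditions each say that the search tree has no child of v, or just one when v is the root,
-- so every other vertex reaches a fixed vertex by iterating parents without meeting v.  Conversely, if G - v is
-- connected, then as long as some vertices other than v are numbered and some are not, an edge of G - v joins two such
-- vertices.  Hence in a search from v a vertex labelled by v alone competes with one labelled by a later vertex; DFS
-- prefers the latter, and so does MCS under a suitable tie-break.  By the same argument a generic search can avoid v
-- until the end, and v is then childless.
module Submission where

open import Data.Bool using (if_then_else_; _∧_)
open import Data.Fin using (Fin; zero; suc; toℕ; fromℕ; fromℕ<)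
import Data.Fin as Fin
import Data.Fin.Properties as Fin
open import Data.Fin.Permutation
  using (_⟨$⟩ʳ_; _⟨$⟩ˡ_; inverseˡ; inverseʳ; transpose; _∘ₚ_) renaming (id to idₚ)
open import Data.Fin.Subset using (Subset; ⊥; ⁅_⁆; _∈_; ∣_∣; Empty; Nonempty)
open import Data.Fin.Subset.Properties
  using (_∈?_; nonempty?; ∉⊥; x∈⁅x⁆; x∈⁅y⁆⇒x≡y; ∣⁅x⁆∣≡1; Empty-unique; ∣⊥∣≡0; x∈p∪q⁻; x∈p∪q⁺; ⊆-antisym; p⊆q⇒∣p∣≤∣q∣)
open import Data.List using (_∷_; []; allFin; filter)
import Data.List.Extrema as Extrema
open import Data.List.Membership.Propositional.Properties using (∈-lookup; ∈-filter⁺; ∈-allFin)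
open import Data.List.Relation.Unary.All as All using (All; _∷_; [])
open import Data.List.Relation.Unary.All.Properties using (all-filter)
import Data.Nat as ℕ
open import Data.Nat using (ℕ; zero; suc; _+_; _*_; _≤_; _<_; z≤n; s≤s; z<s)
open import Data.Nat.Induction using (<-wellFounded; Acc; acc)
open import Data.Nat.Properties
  using (≤-refl; ≤-reflexive; ≤-antisym; ≤-totalOrder; <⇒≤; <⇒≱; ≮⇒≥; <-trans; <-irrefl;
         <-≤-trans; ≤-<-trans; m≤n⇒m<n∨m≡n; m<1+n⇒m≤n; n<1+n; n≢0⇒n>0; m≤m+n; m≤n⇒m≤1+n; +-monoʳ-≤;
         +-monoˡ-≤; *-monoʳ-≤; +-cancelˡ-≤; +-identityʳ; +-monoʳ-<; +-comm; *-suc; n≤0⇒n≡0; n<1⇒n≡0; module ≤-Reasoning)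
open import Data.Product using (∃; ∃₂; _×_; _,_; proj₁; proj₂)
open import Data.Sum using (_⊎_; inj₁; inj₂)
open import Function using (_⇔_; mk⇔; _∘_)
open import Function.Construct.Composition using (_⇔-∘_)
open import Function.Construct.Identity using (⇔-id)
open import Function.Construct.Symmetry using (⇔-sym)
open import Relation.Binary using (Rel)
open import Relation.Binary.Construct.Closure.ReflexiveTransitive as Star using (Star; ε; _◅_; _◅◅_)
open import Relation.Binary.Construct.Closure.Symmetric using (SymClosure; fwd; bwd)
open import Relation.Binary.PropositionalEquality as ≡
  using (_≡_; _≢_; refl; cong; subst; subst₂; trans)
open import Relation.Nullary using (¬_; Dec; yes; no; does; contradiction)
open import Relation.Nullary.Decidable using (_×-dec_; ¬?; decidable-stable; dec-true; dec-false)
open import Relation.Unary using (Pred; Decidable)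
open import Level using (0ℓ)
open import Defs

open Extrema ≤-totalOrder using (argmax; argmax-all; f[xs]≤f[argmax]; argmin; argmin-all; f[argmin]≤f[xs])

-- Extremal elements and edges leaving a set

module _ {n} {P : Pred (Fin n) 0ℓ} (P? : Decidable P) (f : Fin n → ℕ) {x} (px : P x) where

  maximizer : ∃ λ m → P m × (∀ y → P y → f y ≤ f m)
  maximizer = argmax f x candidates , argmax-all f px (all-filter P? (allFin n)) ,
    λ y py → All.lookup (f[xs]≤f[argmax] {f = f} x candidates) (∈-filter⁺ P? (∈-allFin y) py)
    where candidates = filter P? (allFin n)

  minimizer : ∃ λ m → P m × (∀ y → P y → f m ≤ f y)
  minimizer = argmin f x candidates , argmin-all f px (all-filter P? (allFin n)) ,
    λ y py → All.lookup (f[argmin]≤f[xs] {f = f} x candidates) (∈-filter⁺ P? (∈-allFin y) py)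
    where candidates = filter P? (allFin n)

-- The first step of the path that leaves `P` is such an edge. In every use `P` says that a vertex
-- is already numbered.
crossing-edge : ∀ {A : Set} {R : Rel A 0ℓ} {P : Pred A 0ℓ} → Decidable P →
                ∀ {x y} → Star R x y → P x → ¬ P y → ∃₂ λ a b → P a × ¬ P b × R a b
crossing-edge P? ε px ¬px = contradiction px ¬px
crossing-edge P? {x} (_◅_ {j = z} xRz z⋆y) px ¬py with P? z
... | yes pz = crossing-edge P? z⋆y pz ¬py
... | no ¬pz = x , z , px , ¬pz , xRz

if-∧⁻ : ∀ {A B C : Set} (Q : Pred C 0ℓ) (a? : Dec A) (b? : Dec B) {x y} →
        Q (if does a? ∧ does b? then x else y) → (A × B × Q x) ⊎ Q y
if-∧⁻ Q (yes a) (yes b) q = inj₁ (a , b , q)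
if-∧⁻ Q (yes _) (no _)  q = inj₂ q
if-∧⁻ Q (no _)  _       q = inj₂ q

if-∧⁺ : ∀ {A B C : Set} (Q : Pred C 0ℓ) (a? : Dec A) (b? : Dec B) {x y} →
        (A → B → Q x) → (¬ (A × B) → Q y) → Q (if does a? ∧ does b? then x else y)
if-∧⁺ Q (yes a) (yes b) qx qy = qx a b
if-∧⁺ Q (yes _) (no ¬b) qx qy = qy (¬b ∘ proj₂)
if-∧⁺ Q (no ¬a) _       qx qy = qy (¬a ∘ proj₁)

-- Labels as sets of positions of earlier neighbours

labelAt : ∀ {n} → Graph (Fin n) → Ordering n → Fin n → Fin n → Subset n
labelAt G σ i = label G σ (toℕ i) (Fin.toℕ≤n i)

module _ {n} (G : Graph (Fin n)) (σ : Ordering n) where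

  -- Together with `∈-label⁺`, this trades the recursion of `label` for a direct description of its
  -- elements.
  ∈-label⁻ : ∀ k .(k≤n : k ≤ n) {y j} → j ∈ label G σ k k≤n y →
             toℕ j < k × j Fin.< σ ⟨$⟩ˡ y × Adj G (σ ⟨$⟩ʳ j) y
  ∈-label⁻ zero    _   j∈ = contradiction j∈ ∉⊥
  ∈-label⁻ (suc k) k<n {y} {j} j∈
    with if-∧⁻ (j ∈_) (fromℕ< k<n Fin.<? σ ⟨$⟩ˡ y) (adj? G (σ ⟨$⟩ʳ fromℕ< k<n) y) j∈
  ... | inj₂ j∈′ = let j<k , r = ∈-label⁻ k _ j∈′ in m≤n⇒m≤1+n j<k , r
  ... | inj₁ (i<y , adj , j∈′) with x∈p∪q⁻ ⁅ fromℕ< k<n ⁆ _ j∈′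
  ...   | inj₂ j∈″ = let j<k , r = ∈-label⁻ k _ j∈″ in m≤n⇒m≤1+n j<k , r
  ...   | inj₁ j∈i with refl ← x∈⁅y⁆⇒x≡y _ j∈i =
          s≤s (≤-reflexive (Fin.toℕ-fromℕ< k<n)) , i<y , adj

  ∈-label⁺ : ∀ k .(k≤n : k ≤ n) {y j} → toℕ j < k → j Fin.< σ ⟨$⟩ˡ y → Adj G (σ ⟨$⟩ʳ j) y →
             j ∈ label G σ k k≤n y
  ∈-label⁺ (suc k) k<n {y} {j} j<1+k j<y adj with m≤n⇒m<n∨m≡n (m<1+n⇒m≤n j<1+k)
  ... | inj₂ refl = if-∧⁺ (j ∈_) (fromℕ< k<n Fin.<? σ ⟨$⟩ˡ y) (adj? G (σ ⟨$⟩ʳ fromℕ< k<n) y)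
    (λ _ _ → x∈p∪q⁺ (inj₁ (subst (λ i → j ∈ ⁅ i ⁆) (≡.sym (Fin.fromℕ<-toℕ j k<n)) (x∈⁅x⁆ j))))
    (contradiction (subst (λ i → i Fin.< σ ⟨$⟩ˡ y × Adj G (σ ⟨$⟩ʳ i) y)
                          (≡.sym (Fin.fromℕ<-toℕ j k<n)) (j<y , adj)))
  ... | inj₁ j<k = if-∧⁺ (j ∈_) (fromℕ< k<n Fin.<? σ ⟨$⟩ˡ y) (adj? G (σ ⟨$⟩ʳ fromℕ< k<n) y)
    (λ _ _ → x∈p∪q⁺ (inj₂ (∈-label⁺ k _ j<k j<y adj)))
    (λ _ → ∈-label⁺ k _ j<k j<y adj)

  ∈-labelAt⁺ : ∀ {i z y} → σ ⟨$⟩ˡ z Fin.< i → i Fin.≤ σ ⟨$⟩ˡ y → Adj G z y →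
               σ ⟨$⟩ˡ z ∈ labelAt G σ i y
  ∈-labelAt⁺ {i} {z} {y} z<i i≤y adj =
    ∈-label⁺ (toℕ i) _ z<i (<-≤-trans z<i i≤y) (subst (λ z → Adj G z y) (≡.sym (inverseʳ σ)) adj)

  ∈-labelAt⁻ : ∀ {i y j} → j ∈ labelAt G σ i y →
               j Fin.< i × j Fin.< σ ⟨$⟩ˡ y × Adj G (σ ⟨$⟩ʳ j) y
  ∈-labelAt⁻ {i} = ∈-label⁻ (toℕ i) _

module _ {n} (G : Graph (Fin n)) (σ τ : Ordering n) (i : Fin n)
         (agree : ∀ j → j Fin.< i → σ ⟨$⟩ʳ j ≡ τ ⟨$⟩ʳ j) where

  -- A vertex that `τ` places before `i` occupies the same position in `σ`, so it is numbered there
  -- too.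
  unnumbered-agree : ∀ {y} → i Fin.≤ σ ⟨$⟩ˡ y → i Fin.≤ τ ⟨$⟩ˡ y
  unnumbered-agree {y} i≤y = ≮⇒≥ λ τy<i → <⇒≱ τy<i (subst (i Fin.≤_)
    (trans (cong (σ ⟨$⟩ˡ_) (≡.sym (trans (agree _ τy<i) (inverseʳ τ)))) (inverseˡ σ)) i≤y)

  label-agree⊆ : ∀ {y j} → i Fin.≤ τ ⟨$⟩ˡ y → j ∈ labelAt G σ i y → j ∈ labelAt G τ i y
  label-agree⊆ {y} i≤y j∈ = let j<i , _ , adj = ∈-labelAt⁻ G σ {i} j∈ in
    ∈-label⁺ G τ (toℕ i) _ j<i (<-≤-trans j<i i≤y) (subst (λ z → Adj G z y) (agree _ j<i) adj)

label-agree : ∀ {n} (G : Graph (Fin n)) σ τ i → (∀ j → j Fin.< i → σ ⟨$⟩ʳ j ≡ τ ⟨$⟩ʳ j) →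
              ∀ {y} → i Fin.≤ σ ⟨$⟩ˡ y → i Fin.≤ τ ⟨$⟩ˡ y → labelAt G σ i y ≡ labelAt G τ i y
label-agree G σ τ i agree i≤σy i≤τy = ⊆-antisym
  (label-agree⊆ G σ τ i agree i≤τy)
  (label-agree⊆ G τ σ i (λ j j<i → ≡.sym (agree j j<i)) i≤σy)

-- Orderings that greedily maximise a key

module _ {n} (G : Graph (Fin n)) (key : Fin n → Subset n → ℕ) where

  value : Ordering n → Fin n → Fin n → ℕ
  value σ i y = key y (labelAt G σ i y)

  -- The key may depend on the vertex as well as on its label; this is what lets a search be forced
  -- to start or to end in a given vertex.
  GreedyAt : Ordering n → Fin n → Set
  GreedyAt σ i = ∀ y → i Fin.≤ σ ⟨$⟩ˡ y → value σ i y ≤ value σ i (σ ⟨$⟩ʳ i)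

  -- The labels at step `i` depend only on the positions below `i`, so rearranging the positions
  -- above `i` cannot spoil a choice already made.
  GreedyAt-agree : ∀ σ τ i → (∀ j → j Fin.≤ i → σ ⟨$⟩ʳ j ≡ τ ⟨$⟩ʳ j) → GreedyAt σ i → GreedyAt τ i
  GreedyAt-agree σ τ i agree greedy y i≤τy = subst₂ _≤_
    (cong (key y) (label-agree G σ τ i agree< i≤σy i≤τy))
    (trans (cong (key _) (label-agree G σ τ i agree< (≤-reflexive (cong toℕ (≡.sym (inverseˡ σ)))) i≤τσi))
           (cong (value τ i) (agree i ≤-refl)))
    (greedy y i≤σy)
    where
    agree< : ∀ j → j Fin.< i → σ ⟨$⟩ʳ j ≡ τ ⟨$⟩ʳ j
    agree< j j<i = agree j (<⇒≤ j<i)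
    i≤σy = unnumbered-agree G τ σ i (λ j j<i → ≡.sym (agree< j j<i)) i≤τy
    i≤τσi : i Fin.≤ τ ⟨$⟩ˡ (σ ⟨$⟩ʳ i)
    i≤τσi = ≤-reflexive (cong toℕ (≡.sym (trans (cong (τ ⟨$⟩ˡ_) (agree i ≤-refl)) (inverseˡ τ))))

  -- Swapping a best unnumbered vertex into position i leaves the labels at step i unchanged.
  greedy-step : ∀ σ i → ∃ λ τ → (∀ j → j Fin.< i → σ ⟨$⟩ʳ j ≡ τ ⟨$⟩ʳ j) × GreedyAt τ i
  greedy-step σ i = τ , agree , λ y i≤τy → subst₂ _≤_
      (trans (cong (value σ i) (inverseʳ σ)) (cong (key y) (label-agree G σ τ i agree (i≤σ i≤τy) i≤τy)))
      (trans (cong (key _) (label-agree G σ τ i agree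
                (subst (i Fin.≤_) (≡.sym (inverseˡ σ)) i≤p)
                (subst (i Fin.≤_) (≡.sym (trans (cong (τ ⟨$⟩ˡ_) (≡.sym τi)) (inverseˡ τ))) ≤-refl)))
             (cong (value τ i) (≡.sym τi)))
      (best (σ ⟨$⟩ˡ y) (i≤σ i≤τy))
    where
    choice = maximizer (i Fin.≤?_) (λ q → value σ i (σ ⟨$⟩ʳ q)) {i} ≤-refl
    p = proj₁ choice
    i≤p = proj₁ (proj₂ choice)
    best = proj₂ (proj₂ choice)
    τ = transpose i p ∘ₚ σ
    agree : ∀ j → j Fin.< i → σ ⟨$⟩ʳ j ≡ τ ⟨$⟩ʳ j
    agree j j<i
      rewrite dec-false (j Fin.≟ i) (Fin.<⇒≢ j<i)
            | dec-false (j Fin.≟ p) (Fin.<⇒≢ (<-≤-trans j<i i≤p)) = refl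
    τi : τ ⟨$⟩ʳ i ≡ σ ⟨$⟩ʳ p
    τi rewrite dec-true (i Fin.≟ i) refl = refl
    i≤σ : ∀ {y} → i Fin.≤ τ ⟨$⟩ˡ y → i Fin.≤ σ ⟨$⟩ˡ y
    i≤σ = unnumbered-agree G τ σ i (λ j j<i → ≡.sym (agree j j<i))

  greedy-extend : ∀ {k} .(k<n : k < n) σ τ → (∀ j → j Fin.< fromℕ< k<n → σ ⟨$⟩ʳ j ≡ τ ⟨$⟩ʳ j) →
                  (∀ i → toℕ i < k → GreedyAt σ i) → GreedyAt τ (fromℕ< k<n) →
                  ∀ i → toℕ i < suc k → GreedyAt τ i
  greedy-extend {k} k<n σ τ agree greedy greedy-k i i<1+k with m≤n⇒m<n∨m≡n (m<1+n⇒m≤n i<1+k)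
  ... | inj₂ refl = subst (GreedyAt τ) (Fin.fromℕ<-toℕ i k<n) greedy-k
  ... | inj₁ i<k  = GreedyAt-agree σ τ i
    (λ j j≤i → agree j (subst (toℕ j <_) (≡.sym (Fin.toℕ-fromℕ< k<n)) (≤-<-trans j≤i i<k)))
    (greedy i i<k)

  greedy-prefix : ∀ k → k ≤ n → ∃ λ σ → ∀ i → toℕ i < k → GreedyAt σ i
  greedy-prefix zero    _   = idₚ , λ _ ()
  greedy-prefix (suc k) k<n =
    let σ , greedy           = greedy-prefix k (<⇒≤ k<n)
        τ , agree , greedy-k = greedy-step σ (fromℕ< k<n)
    in τ , greedy-extend k<n σ τ agree greedy greedy-k

  greedy-ordering : ∃ λ σ → ∀ i → GreedyAt σ i
  greedy-ordering = let σ , greedy = greedy-prefix n ≤-refl in σ , λ i → greedy i (Fin.toℕ<n i)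

-- Greedy searches from a prescribed vertex

bit : ∀ {A : Set} → Dec A → ℕ
bit (yes _) = 1
bit (no _)  = 0

bit≤1 : ∀ {A : Set} (a? : Dec A) → bit a? ≤ 1
bit≤1 (yes _) = ≤-refl
bit≤1 (no _)  = z≤n

bit-yes : ∀ {A : Set} (a? : Dec A) → A → bit a? ≡ 1
bit-yes (yes _) a = refl
bit-yes (no ¬a) a = contradiction a ¬a

bit-no : ∀ {A : Set} (a? : Dec A) → ¬ A → bit a? ≡ 0
bit-no (yes a) ¬a = contradiction a ¬a
bit-no (no _)  ¬a = refl

Maximizes : ∀ {n} → Graph (Fin n) → (Subset n → ℕ) → Ordering n → Set
Maximizes G f σ = ∀ i y → i Fin.≤ σ ⟨$⟩ˡ y → f (labelAt G σ i y) ≤ f (labelAt G σ i (σ ⟨$⟩ʳ i))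

-- All labels are empty at the first step, so the bonus makes the search start in v.
key-from : ∀ {n} → Fin n → (Subset n → ℕ) → Fin n → Subset n → ℕ
key-from v f y A = f A + bit (y Fin.≟ v)

greedy-starts : ∀ {m} (G : Graph (Fin (suc m))) v f σ → GreedyAt G (key-from v f) σ zero → σ ⟨$⟩ʳ zero ≡ v
greedy-starts G v f σ greedy with σ ⟨$⟩ʳ zero Fin.≟ v | greedy v z≤n
... | yes eq | _ = eq
... | no _   | le = contradiction
  (+-cancelˡ-≤ (f ⊥) _ _ (subst (λ b → f ⊥ + b ≤ f ⊥ + 0) (bit-yes (v Fin.≟ v) refl) le)) λ ()

-- At step zero all labels are `⊥`. Afterwards `v` is numbered, so the chosen vertex has no bonus,
-- and dropping the bonus of its competitor only weakens the inequality.
greedy-maximizes : ∀ {m} (G : Graph (Fin (suc m))) v f σ → σ ⟨$⟩ʳ zero ≡ v →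
                   (∀ i → GreedyAt G (key-from v f) σ i) → Maximizes G f σ
greedy-maximizes G v f σ σ0≡v greedy zero    y _   = ≤-refl
greedy-maximizes G v f σ σ0≡v greedy (suc i) y i≤y = begin
  f (labelAt G σ (suc i) y)                    ≤⟨ m≤m+n _ _ ⟩
  f (labelAt G σ (suc i) y) + bit (y Fin.≟ v)  ≤⟨ greedy (suc i) y i≤y ⟩
  f (labelAt G σ (suc i) x) + bit (x Fin.≟ v)  ≡⟨ cong (f (labelAt G σ (suc i) x) +_) (bit-no (x Fin.≟ v) x≢v) ⟩
  f (labelAt G σ (suc i) x) + 0                ≡⟨ +-identityʳ _ ⟩
  f (labelAt G σ (suc i) x)                    ∎
  where
  open ≤-Reasoning
  x = σ ⟨$⟩ʳ suc i
  x≢v : x ≢ v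
  x≢v x≡v = contradiction
    (trans (≡.sym (inverseˡ σ)) (trans (cong (σ ⟨$⟩ˡ_) (trans x≡v (≡.sym σ0≡v))) (inverseˡ σ))) λ ()

ordering-from : ∀ {n} (G : Graph (Fin n)) v f → ∃ λ σ → IsFirst σ v × Maximizes G f σ
ordering-from {suc _} G v f =
  let σ , greedy = greedy-ordering G (key-from v f)
      σ0≡v       = greedy-starts G v f σ (greedy zero)
  in σ , cong toℕ (trans (cong (σ ⟨$⟩ˡ_) (≡.sym σ0≡v)) (inverseˡ σ)) ,
     greedy-maximizes G v f σ σ0≡v greedy

-- Positions and search trees

module _ {n} (σ : Ordering n) where

  position-injective : ∀ {u w} → σ ⟨$⟩ˡ u ≡ σ ⟨$⟩ˡ w → u ≡ w
  position-injective eq = trans (≡.sym (inverseʳ σ)) (trans (cong (σ ⟨$⟩ʳ_) eq) (inverseʳ σ))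

  PrecedesEq-antisym : ∀ {u w} → PrecedesEq σ u w → PrecedesEq σ w u → u ≡ w
  PrecedesEq-antisym u≤w w≤u = position-injective (Fin.toℕ-injective (≤-antisym u≤w w≤u))

  first-unique : ∀ {u w} → IsFirst σ u → IsFirst σ w → u ≡ w
  first-unique u0 w0 = position-injective (Fin.toℕ-injective (trans u0 (≡.sym w0)))

  last-maximal : ∀ {v} → IsLast σ v → ∀ u → PrecedesEq σ u v
  last-maximal v-last u = m<1+n⇒m≤n (subst (toℕ (σ ⟨$⟩ˡ u) <_) (≡.sym v-last) (Fin.toℕ<n _))

first-vertex : ∀ {n} (σ : Ordering n) → Fin n → ∃ (IsFirst σ)
first-vertex {suc _} σ _ = σ ⟨$⟩ʳ zero , cong toℕ (inverseˡ σ)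

-- The properties that the two kinds of tree share, so that the arguments about leaves are made once
-- for both.
record SearchTree {n} (G : Graph (Fin n)) (σ : Ordering n) (Parent : Rel (Fin n) 0ℓ) : Set where
  field
    nonfirst   : ∀ {u p} → Parent u p → ¬ IsFirst σ u
    adjacent   : ∀ {u p} → Parent u p → Adj G u p
    precedes   : ∀ {u p} → Parent u p → Precedes σ p u
    functional : ∀ {u p q} → Parent u p → Parent u q → p ≡ q
    total      : ∀ {u} → ¬ IsFirst σ u → ∃ (Parent u)

module _ {n} (G : Graph (Fin n)) (σ : Ordering n) (connected : Connected G) (gs : IsGS G σ) where

  -- Otherwise `u` is chosen with an empty label, while a path from the first vertex to `u` has an
  -- edge from a numbered to an unnumbered vertex. The latter has a nonempty label, against the rule
  -- of generic search.
  earlier-neighbour : ∀ {u} → ¬ IsFirst σ u → ∃ λ w → Adj G u w × Precedes σ w u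
  earlier-neighbour {u} u-nonfirst
    with Fin.any? (λ w → adj? G u w ×-dec (σ ⟨$⟩ˡ w Fin.<? σ ⟨$⟩ˡ u))
  ... | yes earlier = earlier
  ... | no ¬earlier =
    let r , r0 = first-vertex σ u
        a , b , a<u , b≮u , adj = crossing-edge (λ x → σ ⟨$⟩ˡ x Fin.<? σ ⟨$⟩ˡ u) (connected r u)
          (subst (_< toℕ (σ ⟨$⟩ˡ u)) (≡.sym r0) (n≢0⇒n>0 u-nonfirst)) (<-irrefl refl)
    in contradiction
      (b , ≮⇒≥ b≮u , subst (λ x → Empty (labelAt G σ (σ ⟨$⟩ˡ u) x)) (≡.sym (inverseʳ σ)) empty
         , σ ⟨$⟩ˡ a , ∈-labelAt⁺ G σ {σ ⟨$⟩ˡ u} a<u (≮⇒≥ b≮u) adj)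
      (gs (σ ⟨$⟩ˡ u))
    where
    empty : Empty (labelAt G σ (σ ⟨$⟩ˡ u) u)
    empty (j , j∈) = let j<u , _ , adj = ∈-labelAt⁻ G σ {σ ⟨$⟩ˡ u} j∈ in
      ¬earlier (σ ⟨$⟩ʳ j , sym G adj , subst (Fin._< σ ⟨$⟩ˡ u) (≡.sym (inverseˡ σ)) j<u)

  L-tree : SearchTree G σ (LParent G σ)
  L-tree = record
    { nonfirst   = proj₁
    ; adjacent   = proj₁ ∘ proj₂
    ; precedes   = proj₁ ∘ proj₂ ∘ proj₂
    ; functional = λ (_ , up , p<u , p-max) (_ , uq , q<u , q-max) →
        PrecedesEq-antisym σ (q-max _ up p<u) (p-max _ uq q<u)
    ; total      = λ {u} u-nonfirst →
        let p , (up , p<u) , p-max = maximizer (λ w → adj? G u w ×-dec (σ ⟨$⟩ˡ w Fin.<? σ ⟨$⟩ˡ u))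
              (toℕ ∘ (σ ⟨$⟩ˡ_)) (proj₂ (earlier-neighbour u-nonfirst))
        in p , u-nonfirst , up , p<u , λ w uw w<u → p-max w (uw , w<u)
    }

  -- The leftmost neighbour precedes the vertex because it is no later than the neighbour given by
  -- `earlier-neighbour`.
  F-tree : SearchTree G σ (FParent G σ)
  F-tree = record
    { nonfirst   = proj₁
    ; adjacent   = proj₁ ∘ proj₂
    ; precedes   = λ (u-nonfirst , _ , p-min) →
        let w , uw , w<u = earlier-neighbour u-nonfirst in ≤-<-trans (p-min w uw) w<u
    ; functional = λ (_ , up , p-min) (_ , uq , q-min) →
        PrecedesEq-antisym σ (p-min _ uq) (q-min _ up)
    ; total      = λ {u} u-nonfirst →
        let p , up , p-min = minimizer (adj? G u) (toℕ ∘ (σ ⟨$⟩ˡ_))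
              (proj₁ (proj₂ (earlier-neighbour u-nonfirst)))
        in p , u-nonfirst , up , p-min
    }

-- Connectedness of `G -ᵛ v` from leaves of search trees

-- Positions decrease along the chosen neighbours, so every vertex of `G -ᵛ v` descends to `r`; two
-- descents joined at `r` form a path.
descent⇒connected : ∀ {n} (G : Graph (Fin n)) σ {v r} → r ≢ v →
  (∀ u → u ≢ v → u ≢ r → ∃ λ p → p ≢ v × Adj G u p × Precedes σ p u) → Connected (G -ᵛ v)
descent⇒connected G σ {v} {r} r≢v parent a b =
  to-root a (<-wellFounded _) ◅◅ Star.reverse (sym G) (to-root b (<-wellFounded _))
  where
  to-root : ∀ a → Acc _<_ (toℕ (σ ⟨$⟩ˡ proj₁ a)) → Star (Adj (G -ᵛ v)) a (r , r≢v)
  to-root (u , u≢v) (acc rec) with u Fin.≟ r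
  ... | yes refl = ε
  ... | no u≢r   = let p , p≢v , up , p<u = parent u u≢v u≢r in up ◅ to-root (p , p≢v) (rec p<u)

module _ {n} (G : Graph (Fin n)) (σ : Ordering n) {Parent : Rel (Fin n) 0ℓ}
         (tree : SearchTree G σ Parent) {v : Fin n} where

  open SearchTree tree

  childless⇒connected : ¬ IsFirst σ v → (∀ w → ¬ Parent w v) → Connected (G -ᵛ v)
  childless⇒connected v-nonfirst childless = let r , r0 = first-vertex σ v in
    descent⇒connected G σ {r = r} (λ r≡v → v-nonfirst (subst (IsFirst σ) r≡v r0)) λ u u≢v u≢r →
      let p , parent = total λ u0 → u≢r (first-unique σ u0 r0)
      in p , (λ p≡v → childless u (subst (Parent u) p≡v parent)) , adjacent parent , precedes parent

  -- The parent of `v` already is its only tree neighbour. A child would coincide with it and so lie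
  -- both before and after `v`.
  leaf⇒childless : ¬ IsFirst σ v → Leaf (SymClosure Parent) v → ∀ w → ¬ Parent w v
  leaf⇒childless v-nonfirst (_ , _ , unique) w w→v =
    let p , v→p = total v-nonfirst
        p≡w = trans (≡.sym (unique (fwd v→p))) (unique (bwd w→v))
    in <-irrefl refl (<-trans (precedes w→v) (subst (λ x → Precedes σ x v) p≡w (precedes v→p)))

  childless⇒leaf : ¬ IsFirst σ v → (∀ w → ¬ Parent w v) → Leaf (SymClosure Parent) v
  childless⇒leaf v-nonfirst childless = let p , v→p = total v-nonfirst in
    p , fwd v→p , λ { (fwd v→q) → functional v→p v→q ; (bwd w→v) → contradiction w→v (childless _) }

  last⇒childless : IsLast σ v → ∀ w → ¬ Parent w v
  last⇒childless v-last w w→v = <⇒≱ (precedes w→v) (last-maximal σ v-last w)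

  -- The root has no parent, so its tree neighbour is a child `c`. All vertices other than `v` and
  -- `c` have a parent different from `v`, hence they descend to `c`.
  root-leaf⇒connected : IsFirst σ v → Leaf (SymClosure Parent) v → Connected (G -ᵛ v)
  root-leaf⇒connected v0 (c , fwd v→c , _)      = contradiction v0 (nonfirst v→c)
  root-leaf⇒connected v0 (c , bwd c→v , unique) =
    descent⇒connected G σ {r = c} (λ c≡v → nonfirst c→v (subst (IsFirst σ) (≡.sym c≡v) v0)) λ u u≢v u≢c →
      let p , u→p = total λ u0 → u≢v (first-unique σ u0 v0)
      in p , (λ p≡v → u≢c (≡.sym (unique (bwd (subst (Parent u) p≡v u→p))))) , adjacent u→p , precedes u→p

-- Numerical ranks compatible with the label orders

∈⇒0<∣∣ : ∀ {n} {A : Subset n} {x} → x ∈ A → 0 < ∣ A ∣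
∈⇒0<∣∣ {x = x} x∈A = subst (_≤ _) (∣⁅x⁆∣≡1 x)
  (p⊆q⇒∣p∣≤∣q∣ λ y∈ → subst (_∈ _) (≡.sym (x∈⁅y⁆⇒x≡y x y∈)) x∈A)

maximum : ∀ {n} {A : Subset n} → Nonempty A → ∃ (IsMax A)
maximum {A = A} (_ , x∈A) =
  let m , m∈A , m-max = maximizer (_∈? A) toℕ x∈A in m , m∈A , λ j∈A → m-max _ j∈A

IsMax-unique : ∀ {n} {A : Subset n} {a b} → IsMax A a → IsMax A b → a ≡ b
IsMax-unique (a∈ , a-max) (b∈ , b-max) = Fin.toℕ-injective (≤-antisym (b-max a∈) (a-max b∈))

≺GS⇒≺MCS : ∀ {n} {A B : Subset n} → A ≺GS B → A ≺MCS B
≺GS⇒≺MCS {n} {A} {B} (A-empty , _ , x∈B) =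
  subst (_< ∣ B ∣) (≡.sym (trans (cong ∣_∣ (Empty-unique A-empty)) (∣⊥∣≡0 n))) (∈⇒0<∣∣ x∈B)

-- The maximum is shifted by one so that the empty label ranks below a label with maximum 0.
dfs-rank : ∀ {n} → Subset n → ℕ
dfs-rank A with nonempty? A
... | yes A-nonempty = suc (toℕ (proj₁ (maximum A-nonempty)))
... | no _           = 0

dfs-rank-empty : ∀ {n} {A : Subset n} → Empty A → dfs-rank A ≡ 0
dfs-rank-empty {A = A} A-empty with nonempty? A
... | yes A-nonempty = contradiction A-nonempty A-empty
... | no _           = refl

dfs-rank-max : ∀ {n} {A : Subset n} {a} → IsMax A a → dfs-rank A ≡ suc (toℕ a)
dfs-rank-max {A = A} {a} a-max with nonempty? A
... | yes A-nonempty = cong (suc ∘ toℕ) (IsMax-unique (proj₂ (maximum A-nonempty)) a-max)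
... | no A-empty     = contradiction (a , proj₁ a-max) A-empty

≺DFS⇒rank< : ∀ {n} {A B : Subset n} → A ≺DFS B → dfs-rank A < dfs-rank B
≺DFS⇒rank< (inj₁ (A-empty , B-nonempty)) =
  subst₂ _<_ (≡.sym (dfs-rank-empty A-empty)) (≡.sym (dfs-rank-max (proj₂ (maximum B-nonempty)))) z<s
≺DFS⇒rank< (inj₂ (_ , _ , a-max , b-max , a<b)) =
  subst₂ _<_ (≡.sym (dfs-rank-max a-max)) (≡.sym (dfs-rank-max b-max)) (s≤s a<b)

has-nonroot? : ∀ {n} (A : Subset n) → Dec (∃ λ j → j ∈ A × toℕ j ≢ 0)
has-nonroot? A = Fin.any? λ j → (j ∈? A) ×-dec ¬? (toℕ j ℕ.≟ 0)

-- Maximum cardinality, with ties broken in favour of labels that are not contained in {0}.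
mcs-rank : ∀ {n} → Subset n → ℕ
mcs-rank A = 2 * ∣ A ∣ + bit (has-nonroot? A)

-- The factor 2 makes a difference of one in cardinality outweigh the tie-breaking bit.
≺MCS⇒rank< : ∀ {n} {A B : Subset n} → A ≺MCS B → mcs-rank A < mcs-rank B
≺MCS⇒rank< {A = A} {B} A<B = begin-strict
  2 * ∣ A ∣ + bit (has-nonroot? A)  ≤⟨ +-monoʳ-≤ (2 * ∣ A ∣) (bit≤1 (has-nonroot? A)) ⟩
  2 * ∣ A ∣ + 1                     <⟨ +-monoʳ-< (2 * ∣ A ∣) (n<1+n 1) ⟩
  2 * ∣ A ∣ + 2                     ≡⟨ +-comm (2 * ∣ A ∣) 2 ⟩
  2 + 2 * ∣ A ∣                     ≡⟨ *-suc 2 ∣ A ∣ ⟨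
  2 * suc ∣ A ∣                     ≤⟨ *-monoʳ-≤ 2 A<B ⟩
  2 * ∣ B ∣                         ≤⟨ m≤m+n _ _ ⟩
  mcs-rank B                        ∎
  where open ≤-Reasoning

maximizes⇒search : (_≺_ : LabelOrder) → ∀ {n} (f : Subset n → ℕ) → (∀ {A B : Subset n} → A ≺ B → f A < f B) →
                   ∀ {G σ} → Maximizes G f σ → IsSearchOrdering _≺_ G σ
maximizes⇒search _≺_ f f-mono σ-max i (y , i≤y , x≺y) = <⇒≱ (f-mono x≺y) (σ-max i y i≤y)

DFS⇒GS : ∀ {n} {G : Graph (Fin n)} {σ} → IsDFS G σ → IsGS G σ
DFS⇒GS dfs i (y , i≤y , x≺y) = dfs i (y , i≤y , inj₁ x≺y)

MCS⇒GS : ∀ {n} {G : Graph (Fin n)} {σ} → IsMCS G σ → IsGS G σ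
MCS⇒GS mcs i (y , i≤y , x≺y) = mcs i (y , i≤y , ≺GS⇒≺MCS x≺y)

-- DFS and MCS orderings that start in a non-cut vertex

second-vertex : ∀ {n} (σ : Ordering n) → 2 ≤ n → ∃ λ c → toℕ (σ ⟨$⟩ˡ c) ≡ 1
second-vertex σ 2≤n = σ ⟨$⟩ʳ fromℕ< 2≤n , trans (cong toℕ (inverseˡ σ)) (Fin.toℕ-fromℕ< 2≤n)

module _ {n} (G : Graph (Fin n)) (σ : Ordering n) {v : Fin n} (v0 : IsFirst σ v) where

  -- The rightmost earlier neighbour of `w` is `v`, at position 0, so no earlier neighbour has a
  -- positive position.
  child-label⁻ : ∀ {w} → LParent G σ w v → ∀ {j} → j ∈ labelAt G σ (σ ⟨$⟩ˡ w) w → toℕ j ≡ 0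
  child-label⁻ {w} (_ , _ , _ , v-max) {j} j∈ =
    let _ , j<w , adj = ∈-labelAt⁻ G σ {σ ⟨$⟩ˡ w} j∈
    in n≤0⇒n≡0 (subst₂ _≤_ (cong toℕ (inverseˡ σ)) v0
         (v-max (σ ⟨$⟩ʳ j) (sym G adj) (subst (Fin._< σ ⟨$⟩ˡ w) (≡.sym (inverseˡ σ)) j<w)))

  child-label⁺ : ∀ {w} → LParent G σ w v → σ ⟨$⟩ˡ v ∈ labelAt G σ (σ ⟨$⟩ˡ w) w
  child-label⁺ {w} (_ , wv , v<w , _) = ∈-labelAt⁺ G σ {σ ⟨$⟩ˡ w} v<w ≤-refl (sym G wv)

  -- The vertex `c` at position 1 is numbered and differs from `v`. A path from `c` to `w` in
  -- `G -ᵛ v` has an edge from a numbered `a` to an unnumbered `b`, and the label of `b` contains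
  -- the nonzero position of `a`. The conclusion is a negation because `¬ CutVertex G v` yields
  -- connectedness only under a double negation.
  some-nonroot-label : ¬ CutVertex G v → ∀ {w} → 1 < toℕ (σ ⟨$⟩ˡ w) →
    ¬ (∀ y → σ ⟨$⟩ˡ w Fin.≤ σ ⟨$⟩ˡ y → ∀ {j} → j ∈ labelAt G σ (σ ⟨$⟩ˡ w) y → toℕ j ≡ 0)
  some-nonroot-label ¬cut {w} 1<w none = ¬cut λ connected →
    let c , c1 = second-vertex σ (<-trans 1<w (Fin.toℕ<n (σ ⟨$⟩ˡ w)))
        (a , a≢v) , (b , _) , a<w , b≮w , ab = crossing-edge (λ x → σ ⟨$⟩ˡ proj₁ x Fin.<? σ ⟨$⟩ˡ w)
          (connected (c , λ c≡v → contradiction (trans (≡.sym c1) (subst (IsFirst σ) (≡.sym c≡v) v0)) λ ())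
                     (w , λ w≡v → contradiction (subst (1 <_) (subst (IsFirst σ) (≡.sym w≡v) v0) 1<w) λ ()))
          (subst (_< toℕ (σ ⟨$⟩ˡ w)) (≡.sym c1) 1<w) (<-irrefl refl)
    in a≢v (first-unique σ (none b (≮⇒≥ b≮w) (∈-labelAt⁺ G σ {σ ⟨$⟩ˡ w} a<w (≮⇒≥ b≮w) ab)) v0)

  -- The parent of the vertex at position 1 can only be at position 0, so it is `v`. Any child of
  -- `v` that is not late is also at position 1, hence the same vertex.
  root-leaf : 2 ≤ n → SearchTree G σ (LParent G σ) →
              (∀ w → LParent G σ w v → ¬ 1 < toℕ (σ ⟨$⟩ˡ w)) → LRootLeaf G σ v
  root-leaf 2≤n tree no-late-child =
    let c , c1       = second-vertex σ 2≤n
        p , c→p      = total {c} λ c0 → contradiction (trans (≡.sym c1) c0) λ ()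
        p0           = n<1⇒n≡0 (subst (toℕ (σ ⟨$⟩ˡ p) <_) c1 (precedes c→p))
    in (c , bwd (subst (LParent G σ c) (first-unique σ p0 v0) c→p) , λ
         { (fwd v→w) → contradiction v0 (nonfirst v→w)
         ; {w} (bwd w→v) → position-injective σ (Fin.toℕ-injective (trans c1 (≡.sym
             (≤-antisym (≮⇒≥ (no-late-child w w→v)) (n≢0⇒n>0 (nonfirst w→v)))))) }) , v0
    where open SearchTree tree

  -- The label of a late child has maximum 0, so an unnumbered vertex with a nonzero position in its
  -- label would have been preferred.
  DFS-no-late-child : IsDFS G σ → ¬ CutVertex G v → ∀ w → LParent G σ w v → ¬ 1 < toℕ (σ ⟨$⟩ˡ w)
  DFS-no-late-child dfs ¬cut w w→v 1<w = some-nonroot-label ¬cut 1<w λ y w≤y {j} j∈ →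
    let m , m-max = maximum (j , j∈) in
    decidable-stable (toℕ j ℕ.≟ 0) λ j≢0 → dfs (σ ⟨$⟩ˡ w)
      ( y , w≤y , inj₂ (σ ⟨$⟩ˡ v , m
      , subst (λ x → IsMax (labelAt G σ (σ ⟨$⟩ˡ w) x) (σ ⟨$⟩ˡ v)) (≡.sym (inverseʳ σ)) root-max
      , m-max , subst (_< toℕ m) (≡.sym v0) (<-≤-trans (n≢0⇒n>0 j≢0) (proj₂ m-max j∈))))
    where
    root-max : IsMax (labelAt G σ (σ ⟨$⟩ˡ w) w) (σ ⟨$⟩ˡ v)
    root-max = child-label⁺ w→v , λ j∈ → subst (_≤ _) (≡.sym (child-label⁻ w→v j∈)) z≤n

  -- The label of a late child lies in `{0}`, which gives rank at most 2; a label with a nonzero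
  -- element has rank at least 3.
  mcs-no-late-child : Maximizes G mcs-rank σ → ¬ CutVertex G v →
                      ∀ w → LParent G σ w v → ¬ 1 < toℕ (σ ⟨$⟩ˡ w)
  mcs-no-late-child σ-max ¬cut w w→v 1<w = some-nonroot-label ¬cut 1<w λ y w≤y {j} j∈ →
    decidable-stable (toℕ j ℕ.≟ 0) λ j≢0 → <⇒≱ (begin-strict
      mcs-rank (L (σ ⟨$⟩ʳ i))  ≡⟨ cong (mcs-rank ∘ L) (inverseʳ σ) ⟩
      mcs-rank (L w)           ≡⟨ cong (2 * ∣ L w ∣ +_) (bit-no (has-nonroot? (L w))
                                    λ (_ , j∈ , j≢0) → j≢0 (child-label⁻ w→v j∈)) ⟩
      2 * ∣ L w ∣ + 0          ≤⟨ +-monoˡ-≤ 0 (*-monoʳ-≤ 2 ∣Lw∣≤1) ⟩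
      2                        <⟨ n<1+n 2 ⟩
      3                        ≤⟨ +-monoˡ-≤ 1 (*-monoʳ-≤ 2 (∈⇒0<∣∣ j∈)) ⟩
      2 * ∣ L y ∣ + 1          ≡⟨ cong (2 * ∣ L y ∣ +_) (bit-yes (has-nonroot? (L y)) (j , j∈ , j≢0)) ⟨
      mcs-rank (L y)           ∎) (σ-max i y w≤y)
    where
    open ≤-Reasoning
    i = σ ⟨$⟩ˡ w
    L = labelAt G σ i
    ∣Lw∣≤1 : ∣ L w ∣ ≤ 1
    ∣Lw∣≤1 = subst (∣ L w ∣ ≤_) (∣⁅x⁆∣≡1 (σ ⟨$⟩ˡ v)) (p⊆q⇒∣p∣≤∣q∣ λ j∈ →
      subst (_∈ ⁅ σ ⟨$⟩ˡ v ⁆) (Fin.toℕ-injective (trans v0 (≡.sym (child-label⁻ w→v j∈)))) (x∈⁅x⁆ _))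

-- Generic searches that end in a non-cut vertex

module _ {n} (v : Fin n) where

  -- The value 0 postpones `v` whatever its label; the values 1 and 2 order the other vertices as
  -- generic search does.
  key-last : Fin n → Subset n → ℕ
  key-last y A with y Fin.≟ v
  ... | yes _ = 0
  ... | no _  = suc (bit (nonempty? A))

  key-last-v : ∀ A → key-last v A ≡ 0
  key-last-v A with v Fin.≟ v
  ... | yes _  = refl
  ... | no v≢v = contradiction refl v≢v

  key-last-≢ : ∀ {y} A → y ≢ v → key-last y A ≡ suc (bit (nonempty? A))
  key-last-≢ {y} A y≢v with y Fin.≟ v
  ... | yes y≡v = contradiction y≡v y≢v
  ... | no _    = refl

-- When `v` is chosen, the vertex `x` at the last position is still unnumbered. If it were not `v`,
-- its positive key would beat the key 0 of `v`.
greedy-last : ∀ {n} (G : Graph (Fin n)) v σ → (∀ i → GreedyAt G (key-last v) σ i) → IsLast σ v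
greedy-last {suc m} G v σ greedy =
  cong suc (trans (cong toℕ (trans (cong (σ ⟨$⟩ˡ_) (≡.sym x≡v)) (inverseˡ σ))) (Fin.toℕ-fromℕ m))
  where
  x = σ ⟨$⟩ʳ fromℕ m
  i = σ ⟨$⟩ˡ v
  v≤x : i Fin.≤ σ ⟨$⟩ˡ x
  v≤x = subst (i Fin.≤_) (≡.sym (inverseˡ σ)) (Fin.≤fromℕ i)
  x≡v : x ≡ v
  x≡v = decidable-stable (x Fin.≟ v) λ x≢v → contradiction (subst₂ _≤_ (key-last-≢ v _ x≢v)
    (trans (cong (λ y → key-last v y (labelAt G σ i y)) (inverseʳ σ)) (key-last-v v _))
    (greedy i x v≤x)) λ ()

-- The competitor `y` may be `v`, whose key is 0, so it need not refute the choice of `x`. Instead,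
-- a path in `G -ᵛ v` from the numbered `z` to `x` yields an unnumbered `b` other than `v` with
-- nonempty label; its key 2 exceeds the key 1 of `x`.
greedy-last⇒GS : ∀ {n} (G : Graph (Fin n)) v σ → ¬ CutVertex G v → IsLast σ v →
                 (∀ i → GreedyAt G (key-last v) σ i) → IsGS G σ
greedy-last⇒GS G v σ ¬cut v-last greedy i (y , i≤y , x-empty , j , j∈) = ¬cut λ connected →
  let (a , _) , (b , b≢v) , a<i , b≮i , ab = crossing-edge (λ u → σ ⟨$⟩ˡ proj₁ u Fin.<? i)
        (connected (z , z≢v) (x , x≢v)) z<i (<-irrefl (cong toℕ (inverseˡ σ)))
      b-nonempty = σ ⟨$⟩ˡ a , ∈-labelAt⁺ G σ {i} a<i (≮⇒≥ b≮i) ab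
  in contradiction
    (subst₂ _≤_ (trans (key-last-≢ v _ b≢v) (cong suc (bit-yes (nonempty? _) b-nonempty)))
                (trans (key-last-≢ v _ x≢v) (cong suc (bit-no (nonempty? _) x-empty)))
                (greedy i b (≮⇒≥ b≮i))) λ { (s≤s ()) }
  where
  x = σ ⟨$⟩ʳ i
  z = σ ⟨$⟩ʳ j
  z<i : σ ⟨$⟩ˡ z Fin.< i
  z<i = subst (Fin._< i) (≡.sym (inverseˡ σ)) (proj₁ (∈-labelAt⁻ G σ {i} j∈))
  z<x : Precedes σ z x
  z<x = subst (σ ⟨$⟩ˡ z Fin.<_) (≡.sym (inverseˡ σ)) z<i
  z≢v : z ≢ v
  z≢v z≡v = <⇒≱ z<x (subst (PrecedesEq σ x) (≡.sym z≡v) (last-maximal σ v-last x))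
  -- If `x` were `v`, it would be the only unnumbered vertex left, so `y` would equal `x` and the
  -- empty label would contain `j`.
  x≢v : x ≢ v
  x≢v x≡v = x-empty (j , subst (λ u → j ∈ labelAt G σ i u) (PrecedesEq-antisym σ
    (subst (PrecedesEq σ y) (≡.sym x≡v) (last-maximal σ v-last y))
    (subst (Fin._≤ σ ⟨$⟩ˡ y) (≡.sym (inverseˡ σ)) i≤y)) j∈)

last⇒nonfirst : ∀ {n} (σ : Ordering n) {v} → 2 ≤ n → IsLast σ v → ¬ IsFirst σ v
last⇒nonfirst σ 2≤n v-last v0 = contradiction (subst (2 ≤_) (trans (≡.sym v-last) (cong suc v0)) 2≤n) λ { (s≤s ()) }

-- Assembling the equivalences

-- Reduces the equivalences to comparisons with one central statement `Q`, which will be (viii).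
equivalent-to : ∀ {Q : Set} {Ps} → All (_⇔ Q) Ps → AllEquivalent Ps
equivalent-to es i j = ⇔-sym (All.lookup es (∈-lookup j)) ⇔-∘ All.lookup es (∈-lookup i)

module Implications {n} (G : Graph (Fin n)) (2≤n : 2 ≤ n) (connected : Connected G) (v : Fin n) where

  root-leaf⇒¬cut : ∀ σ → IsGS G σ → LRootLeaf G σ v → ¬ CutVertex G v
  root-leaf⇒¬cut σ gs (leaf , v0) cut =
    cut (root-leaf⇒connected G σ (L-tree G σ connected gs) v0 leaf)

  branch-leaf⇒¬cut : ∀ σ {Parent} → SearchTree G σ Parent → Leaf (SymClosure Parent) v × ¬ IsFirst σ v →
                     ¬ CutVertex G v
  branch-leaf⇒¬cut σ tree (leaf , v-nonfirst) cut =
    cut (childless⇒connected G σ tree v-nonfirst (leaf⇒childless G σ tree v-nonfirst leaf))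

  last⇒¬cut : ∀ σ → IsGS G σ → IsLast σ v → ¬ CutVertex G v
  last⇒¬cut σ gs v-last cut = cut (childless⇒connected G σ tree (last⇒nonfirst σ 2≤n v-last)
    (last⇒childless G σ tree v-last))
    where tree = L-tree G σ connected gs

  last⇒branch-leaf : ∀ σ {Parent} → SearchTree G σ Parent → IsLast σ v →
                     Leaf (SymClosure Parent) v × ¬ IsFirst σ v
  last⇒branch-leaf σ tree v-last = childless⇒leaf G σ tree v-nonfirst (last⇒childless G σ tree v-last) , v-nonfirst
    where v-nonfirst = last⇒nonfirst σ 2≤n v-last

  -- Ensures that the universal statement (ii) is not vacuous, so that it implies (viii).
  DFS-from : ∃ λ σ → IsDFS G σ × IsFirst σ v
  DFS-from = let σ , v0 , σ-max = ordering-from G v dfs-rank in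
    σ , maximizes⇒search _≺DFS_ dfs-rank ≺DFS⇒rank< σ-max , v0

  ¬cut⇒DFS-root-leaf : ¬ CutVertex G v → ∀ σ → IsDFS G σ → IsFirst σ v → LRootLeaf G σ v
  ¬cut⇒DFS-root-leaf ¬cut σ dfs v0 = root-leaf G σ v0 2≤n
    (L-tree G σ connected (DFS⇒GS dfs)) (DFS-no-late-child G σ v0 dfs ¬cut)

  ¬cut⇒MCS-root-leaf : ¬ CutVertex G v → ∃ λ σ → IsMCS G σ × LRootLeaf G σ v
  ¬cut⇒MCS-root-leaf ¬cut =
    let σ , v0 , σ-max = ordering-from G v mcs-rank
        mcs = maximizes⇒search _≺MCS_ mcs-rank (λ {A} {B} → ≺MCS⇒rank< {A = A} {B}) σ-max
    in σ , mcs , root-leaf G σ v0 2≤n (L-tree G σ connected (MCS⇒GS mcs))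
                   (mcs-no-late-child G σ v0 σ-max ¬cut)

  ¬cut⇒GS-last : ¬ CutVertex G v → ∃ λ σ → IsGS G σ × IsLast σ v
  ¬cut⇒GS-last ¬cut =
    let σ , greedy = greedy-ordering G (key-last v)
        v-last = greedy-last G v σ greedy
    in σ , greedy-last⇒GS G v σ ¬cut v-last greedy , v-last

theorem1 : ∀ (n : ℕ) (G : Graph (Fin n)) → 2 ≤ n → Connected G → (v : Fin n) →
    AllEquivalent
    ( (∃ λ σ → IsDFS G σ × IsFirst σ v × LRootLeaf G σ v)
    ∷ (∀ σ → IsDFS G σ → IsFirst σ v → LRootLeaf G σ v)
    ∷ (∃ λ σ → IsMCS G σ × LRootLeaf G σ v)
    ∷ (∃ λ σ → IsGS G σ × LRootLeaf G σ v)
    ∷ (∃ λ σ → IsGS G σ × LBranchLeaf G σ v)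
    ∷ (∃ λ σ → IsGS G σ × FBranchLeaf G σ v)
    ∷ (∃ λ σ → IsGS G σ × IsLast σ v)
    ∷ (¬ CutVertex G v)
    ∷ [] )
theorem1 n G 2≤n connected v = equivalent-to
  ( mk⇔ (λ (σ , dfs , _ , leaf) → root-leaf⇒¬cut σ (DFS⇒GS dfs) leaf)
        (λ ¬cut → let σ , dfs , v0 = DFS-from in σ , dfs , v0 , ¬cut⇒DFS-root-leaf ¬cut σ dfs v0)
  ∷ mk⇔ (λ all → let σ , dfs , v0 = DFS-from in root-leaf⇒¬cut σ (DFS⇒GS dfs) (all σ dfs v0))
        ¬cut⇒DFS-root-leaf
  ∷ mk⇔ (λ (σ , mcs , leaf) → root-leaf⇒¬cut σ (MCS⇒GS mcs) leaf)
        ¬cut⇒MCS-root-leaf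
  ∷ mk⇔ (λ (σ , gs , leaf) → root-leaf⇒¬cut σ gs leaf)
        (λ ¬cut → let σ , mcs , leaf = ¬cut⇒MCS-root-leaf ¬cut in σ , MCS⇒GS mcs , leaf)
  ∷ mk⇔ (λ (σ , gs , leaf) → branch-leaf⇒¬cut σ (L-tree G σ connected gs) leaf)
        (λ ¬cut → let σ , gs , v-last = ¬cut⇒GS-last ¬cut in
          σ , gs , last⇒branch-leaf σ (L-tree G σ connected gs) v-last)
  ∷ mk⇔ (λ (σ , gs , leaf) → branch-leaf⇒¬cut σ (F-tree G σ connected gs) leaf)
        (λ ¬cut → let σ , gs , v-last = ¬cut⇒GS-last ¬cut in
          σ , gs , last⇒branch-leaf σ (F-tree G σ connected gs) v-last)
  ∷ mk⇔ (λ (σ , gs , v-last) → last⇒¬cut σ gs v-last)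
        ¬cut⇒GS-last
  ∷ ⇔-id _
  ∷ [] )
  where open Implications G 2≤n connected v
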